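{- There is a function $f$ such that, for any positive integer $k$, every connected graph with order at least $f(k)$ contains a parallel minor isomorphic to $K_{1,k}$, $C_k$, $P_k$, or $K_k$.
   Context: All graphs are finite and simple; the order of a graph is its number of vertices. A graph $M$ is a parallel minor of a graph $G$ if $M$ is (isomorphic to) the simple graph obtained from $G$ by contracting some set of edges and then deleting all loops and all but one edge from each class of parallel edges. $K_{1,k}$ is the star with $k$ leaves, $C_k$ is the cycle on $k$ vertices, $P_k$ is the path on $k$ vertices, and $K_k$ is the complete graph on $k$ vertices. -}

module Defs where

open import Data.Nat using (ℕ; zero; suc; _≤_)
open import Data.Nat.Properties using (_≟_)
open import Data.Fin using (Fin; toℕ) renaming (zero to fzero)
import Data.Fin.Properties as FinP
open import Data.Product using (Σ; ∃; _×_; _,_; proj₁; proj₂)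
open import Data.Sum using (_⊎_; inj₁; inj₂; swap)
open import Data.Empty using (⊥)
open import Relation.Nullary using (¬_; Dec; ¬?)
open import Relation.Nullary.Decidable.Core using (_×-dec_; _⊎-dec_)
open import Relation.Binary.PropositionalEquality using (_≡_; _≢_; refl; sym)
open import Function.Bundles using (_⇔_)
open import Function.Definitions using (Surjective)

record Graph : Set₁ where
  field
    order  : ℕ
    Adj    : Fin order → Fin order → Set
    adj-sym    : ∀ {x y} → Adj x y → Adj y x
    adj-irrefl : ∀ {x} → ¬ Adj x x
    adj-dec    : ∀ x y → Dec (Adj x y)

open Graph public

data Reach {n : ℕ} (R : Fin n → Fin n → Set) : Fin n → Fin n → Set where
  here : ∀ {x} → Reach R x x
  step : ∀ {x y z} → (R x y ⊎ R y x) → Reach R y z → Reach R x z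

Connected : Graph → Set
Connected G = ∀ x y → Reach (Adj G) x y

-- Parallel minors.
-- Contracting an edge set F ⊆ E(G) identifies the vertices of each
-- connected component of (V(G), F); after removing loops and parallel
-- edges, two distinct components are adjacent iff some edge of G joins
-- them.  M is (isomorphic to) this graph iff there is a surjection
-- φ : V(G) → V(M) whose fibres are exactly the components of (V(G), F)
-- and M's adjacency is the induced one.

record ParallelMinor (M G : Graph) : Set₁ where
  field
    F      : Fin (order G) → Fin (order G) → Set
    F⊆E    : ∀ {x y} → F x y → Adj G x y
    φ      : Fin (order G) → Fin (order M)
    φ-surj : Surjective _≡_ _≡_ φ
    φ-fibres : ∀ x y → (φ x ≡ φ y) ⇔ Reach F x y
    φ-adj  : ∀ a b → Adj M a b ⇔
               (a ≢ b × Σ (Fin (order G)) λ x → Σ (Fin (order G)) λ y →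
                  φ x ≡ a × φ y ≡ b × Adj G x y)

Complete : ℕ → Graph
Complete k = record
  { order = k
  ; Adj = λ i j → i ≢ j
  ; adj-sym = λ p q → p (sym q)
  ; adj-irrefl = λ p → p refl
  ; adj-dec = λ i j → ¬? (i FinP.≟ j)
  }

private
  n≢1+n : ∀ {n} → ¬ suc n ≡ n
  n≢1+n ()

Path : ℕ → Graph
Path k = record
  { order = k
  ; Adj = λ i j → suc (toℕ i) ≡ toℕ j ⊎ suc (toℕ j) ≡ toℕ i
  ; adj-sym = swap
  ; adj-irrefl = λ { (inj₁ p) → n≢1+n p ; (inj₂ p) → n≢1+n p }
  ; adj-dec = λ i j → (suc (toℕ i) ≟ toℕ j) ⊎-dec (suc (toℕ j) ≟ toℕ i)
  }

Star : ℕ → Graph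
Star k = record
  { order = suc k
  ; Adj = λ i j → (i ≡ fzero × j ≢ fzero) ⊎ (j ≡ fzero × i ≢ fzero)
  ; adj-sym = swap
  ; adj-irrefl = λ { (inj₁ (p , q)) → q p ; (inj₂ (p , q)) → q p }
  ; adj-dec = λ i j → ((i FinP.≟ fzero) ×-dec ¬? (j FinP.≟ fzero))
                  ⊎-dec ((j FinP.≟ fzero) ×-dec ¬? (i FinP.≟ fzero))
  }

-- C_k : vertices 0,…,k-1, i ~ j iff i ≠ j and j ≡ i + 1 (mod k) or
-- i ≡ j + 1 (mod k).  (For k ≥ 3 this is the k-cycle.)
Succ : (k : ℕ) → Fin k → Fin k → Set
Succ k i j = suc (toℕ i) ≡ toℕ j ⊎ (suc (toℕ i) ≡ k × toℕ j ≡ 0)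

Succ-dec : ∀ k i j → Dec (Succ k i j)
Succ-dec k i j = (suc (toℕ i) ≟ toℕ j) ⊎-dec ((suc (toℕ i) ≟ k) ×-dec (toℕ j ≟ 0))

Cycle : ℕ → Graph
Cycle k = record
  { order = k
  ; Adj = λ i j → i ≢ j × (Succ k i j ⊎ Succ k j i)
  ; adj-sym = λ { (p , q) → (λ e → p (sym e)) , swap q }
  ; adj-irrefl = λ { (p , _) → p refl }
  ; adj-dec = λ i j → ¬? (i FinP.≟ j) ×-dec (Succ-dec k i j ⊎-dec Succ-dec k j i)
  }

{-# OPTIONS --safe #-}
module Submission where

-- If a connected set C has many neighbours, split V(G) into connected cells around C and these
-- neighbours and apply Ramsey's theorem to the cells: merging all cells outside a homogeneous set
-- with that of C leaves a star or a complete graph.  Otherwise every ball around a vertex v has few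
-- neighbours, so some p is far away from v, and the sets A t = (component of p outside the ball of
-- radius t) form a long decreasing chain of connected sets with connected complements and narrow
-- frontiers.  Cut such a chain into k slabs A i ∖ A j of equal length.  If all of them are connected,
-- contracting each gives a path, or a cycle if the first and last parts are adjacent.  If one is
-- disconnected, any of its components X gives a shorter, strictly narrower chain, in which the other
-- components of the slab join the part of v, so the first and last parts become adjacent.
-- Induction on the width.

open import Defs
open import Data.Nat using (ℕ; zero; suc; _+_; _*_; _^_; _≤_; _<_; z≤n; s≤s; z<s; _≤?_; _≤′_; ≤′-reflexive; ≤′-step)
open import Data.Nat.Properties
open import Data.Fin using (Fin; toℕ; fromℕ<) renaming (zero to fzero; suc to fsuc)
import Data.Fin.Properties as Fin
open import Data.List using (List; []; _∷_; _++_; length; lookup; filter; allFin)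
open import Data.List.Properties using (length-++; length-tabulate)
open import Data.List.Membership.Propositional using (_∈_; _∉_)
open import Data.List.Membership.Propositional.Properties using (∈-lookup; ∈-allFin; ∈-filter⁺; ∈-filter⁻; ∈-++⁺ˡ; ∈-++⁺ʳ)
import Data.List.Membership.DecPropositional as DecMembership
open import Data.List.Relation.Unary.Any using (Any; here; there; index)
open import Data.List.Relation.Unary.Any.Properties using (lookup-index)
open import Data.List.Relation.Unary.All as All using (All; []; _∷_)
open import Data.List.Relation.Unary.AllPairs using (AllPairs; []; _∷_)
open import Data.List.Relation.Unary.Unique.Propositional using (Unique)
open import Data.List.Relation.Unary.Unique.Propositional.Properties using (filter⁺; allFin⁺)
open import Data.Product using (Σ; ∃; ∃₂; _×_; _,_; proj₁; proj₂)
open import Data.Sum as Sum using (_⊎_; inj₁; inj₂; [_,_]′)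
open import Data.Unit using (⊤; tt)
open import Function using (_∘_; id)
open import Function.Bundles using (mk⇔)
open import Relation.Nullary using (¬_; Dec; yes; no; ¬?; contradiction)
open import Relation.Nullary.Decidable using (_×-dec_; _⊎-dec_; decidable-stable; map′)
open import Relation.Binary.Definitions using (tri<; tri≈; tri>; Symmetric)
open import Relation.Binary.PropositionalEquality using (_≡_; _≢_; refl; sym; trans; cong; subst)

-- Duplicate-free lists and counting

AllPairs-lookup : ∀ {A : Set} {R : A → A → Set} → Symmetric R → ∀ {xs} → AllPairs R xs →
  ∀ {i j} → i ≢ j → R (lookup xs i) (lookup xs j)
AllPairs-lookup R-sym (r ∷ rs) {fzero}  {fzero}  i≢j = contradiction refl i≢j
AllPairs-lookup R-sym (r ∷ rs) {fzero}  {fsuc j} i≢j = All.lookup r (∈-lookup j)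
AllPairs-lookup R-sym (r ∷ rs) {fsuc i} {fzero}  i≢j = R-sym (All.lookup r (∈-lookup i))
AllPairs-lookup R-sym (r ∷ rs) {fsuc i} {fsuc j} i≢j = AllPairs-lookup R-sym rs (i≢j ∘ cong fsuc)

Unique⇒lookup-injective : ∀ {A : Set} {xs : List A} → Unique xs →
  ∀ {i j} → lookup xs i ≡ lookup xs j → i ≡ j
Unique⇒lookup-injective xs! {i} {j} eq =
  decidable-stable (i Fin.≟ j) (λ i≢j → AllPairs-lookup (_∘ sym) xs! i≢j eq)

-- Sending each position in `xs` to the position of its entry in `ys` is injective.
Unique-⊆⇒length≤ : ∀ {A : Set} {xs ys : List A} → Unique xs → (∀ {x} → x ∈ xs → x ∈ ys) →
  length xs ≤ length ys
Unique-⊆⇒length≤ {xs = xs} {ys} xs! xs⊆ys = Fin.injective⇒≤ {f = λ i → index (xs⊆ys (∈-lookup i))} inj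
  where
  inj : ∀ {i j} → index (xs⊆ys (∈-lookup {xs = xs} i)) ≡ index (xs⊆ys (∈-lookup {xs = xs} j)) → i ≡ j
  inj {i} {j} eq = Unique⇒lookup-injective xs!
    (trans (lookup-index (xs⊆ys (∈-lookup i)))
      (trans (cong (lookup ys) eq) (sym (lookup-index (xs⊆ys (∈-lookup j))))))

length-filter-split : ∀ {A : Set} {P : A → Set} (P? : ∀ x → Dec (P x)) xs →
  length (filter P? xs) + length (filter (¬? ∘ P?) xs) ≡ length xs
length-filter-split P? [] = refl
length-filter-split P? (x ∷ xs) with P? x
... | yes _ = cong suc (length-filter-split P? xs)
... | no  _ = trans (+-suc _ _) (cong suc (length-filter-split P? xs))

+-≤-split : ∀ a b {c d} → a + b ≤ c + d → a ≤ c ⊎ b ≤ d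
+-≤-split a b {c} {d} le with a ≤? c | b ≤? d
... | yes p | _     = inj₁ p
... | no  _ | yes q = inj₂ q
... | no ¬p | no ¬q = contradiction le (<⇒≱ (+-mono-< (≰⇒> ¬p) (≰⇒> ¬q)))

¬∃Fin⇒¬ : ∀ {m} {P : ℕ → Set} → ¬ (∃ λ (i : Fin m) → P (toℕ i)) → ∀ {t} → t < m → ¬ P t
¬∃Fin⇒¬ {P = P} ¬∃ t<m q = ¬∃ (fromℕ< t<m , subst P (sym (Fin.toℕ-fromℕ< t<m)) q)

-- Ramsey's theorem for lists

ramsey : ℕ → ℕ → ℕ
ramsey zero    _       = 0
ramsey (suc _) zero    = 0
ramsey (suc a) (suc b) = suc (ramsey a (suc b) + ramsey (suc a) b)

module _ {A : Set} {E : A → A → Set} (E? : ∀ x y → Dec (E x y)) where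

  Homogeneous : ℕ → ℕ → List A → Set
  Homogeneous a b ys = (length ys ≡ a × AllPairs E ys) ⊎ (length ys ≡ b × AllPairs (λ x y → ¬ E x y) ys)

  -- The tail splits into the entries related to `x` and the others, and one of the two is long
  -- enough for the recursion. The head `x` then extends a clique found among the former or an
  -- independent set found among the latter.
  ramsey-theorem : ∀ a b {xs} → Unique xs → ramsey a b ≤ length xs →
    ∃ λ ys → (∀ {y} → y ∈ ys → y ∈ xs) × Unique ys × Homogeneous a b ys
  ramsey-theorem zero    b       xs! le = [] , (λ ()) , [] , inj₁ (refl , [])
  ramsey-theorem (suc a) zero    xs! le = [] , (λ ()) , [] , inj₂ (refl , [])
  ramsey-theorem (suc a) (suc b) {x ∷ xs} (x∉xs ∷ xs!) (s≤s le)
    with +-≤-split (ramsey a (suc b)) (ramsey (suc a) b)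
           (subst (_ ≤_) (sym (length-filter-split (E? x) xs)) le)
  ... | inj₁ le₁ with ramsey-theorem a (suc b) (filter⁺ (E? x) xs!) le₁
  ...   | ys , ys⊆ , ys! , inj₂ ind = ys , there ∘ proj₁ ∘ ∈-filter⁻ (E? x) ∘ ys⊆ , ys! , inj₂ ind
  ...   | ys , ys⊆ , ys! , inj₁ (refl , cl) =
          x ∷ ys , (λ { (here e) → here e ; (there i) → there (proj₁ (∈-filter⁻ (E? x) (ys⊆ i))) }) ,
          All.tabulate (λ i → All.lookup x∉xs (proj₁ (∈-filter⁻ (E? x) (ys⊆ i)))) ∷ ys! ,
          inj₁ (refl , All.tabulate (λ i → proj₂ (∈-filter⁻ (E? x) {xs = xs} (ys⊆ i))) ∷ cl)
  ramsey-theorem (suc a) (suc b) {x ∷ xs} (x∉xs ∷ xs!) (s≤s le)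
      | inj₂ le₂ with ramsey-theorem (suc a) b (filter⁺ (¬? ∘ E? x) xs!) le₂
  ...   | ys , ys⊆ , ys! , inj₁ cl = ys , there ∘ proj₁ ∘ ∈-filter⁻ (¬? ∘ E? x) ∘ ys⊆ , ys! , inj₁ cl
  ...   | ys , ys⊆ , ys! , inj₂ (refl , ind) =
          x ∷ ys , (λ { (here e) → here e ; (there i) → there (proj₁ (∈-filter⁻ (¬? ∘ E? x) (ys⊆ i))) }) ,
          All.tabulate (λ i → All.lookup x∉xs (proj₁ (∈-filter⁻ (¬? ∘ E? x) (ys⊆ i)))) ∷ ys! ,
          inj₂ (refl , All.tabulate (λ i → proj₂ (∈-filter⁻ (¬? ∘ E? x) {xs = xs} (ys⊆ i))) ∷ ind)

-- First entry of a list with a decidable property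

first : ∀ {A : Set} {P : A → Set} → (∀ a → Dec (P a)) → A → List A → A
first P? d []       = d
first P? d (x ∷ xs) with P? x
... | yes _ = x
... | no  _ = first P? d xs

module _ {A : Set} {P : A → Set} (P? : ∀ a → Dec (P a)) (d : A) where

  first-satisfies : ∀ {xs} → Any P xs → first P? d xs ∈ xs × P (first P? d xs)
  first-satisfies {x ∷ xs} any with P? x | any
  ... | yes p | _        = here refl , p
  ... | no ¬p | here p   = contradiction p ¬p
  ... | no ¬p | there ps = let i , p = first-satisfies ps in there i , p

  first-head : ∀ {x xs} → P x → first P? d (x ∷ xs) ≡ x
  first-head {x} p with P? x
  ... | yes _ = refl
  ... | no ¬p = contradiction p ¬p

  first-cong : ∀ {Q : A → Set} (Q? : ∀ a → Dec (Q a)) → (∀ {a} → P a → Q a) → (∀ {a} → Q a → P a) →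
    ∀ xs → first P? d xs ≡ first Q? d xs
  first-cong Q? P⇒Q Q⇒P [] = refl
  first-cong Q? P⇒Q Q⇒P (x ∷ xs) with P? x | Q? x
  ... | yes _ | yes _ = refl
  ... | yes p | no ¬q = contradiction (P⇒Q p) ¬q
  ... | no ¬p | yes q = contradiction (Q⇒P q) ¬p
  ... | no  _ | no  _ = first-cong Q? P⇒Q Q⇒P xs

-- Walks and their decidability

module Contraction (G : Graph) where

  V : Set
  V = Fin (order G)

  open DecMembership (Fin._≟_ {order G}) using (_∈?_)

  infix 4 _~_
  _~_ : V → V → Set
  _~_ = Adj G

  data Walk (P : V → Set) : V → V → Set where
    stop : ∀ {x} → P x → Walk P x x
    step : ∀ {x y z} → P x → x ~ y → Walk P y z → Walk P x z

  start : ∀ {P x y} → Walk P x y → P x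
  start (stop p)     = p
  start (step p _ _) = p

  end : ∀ {P x y} → Walk P x y → P y
  end (stop p)     = p
  end (step _ _ w) = end w

  mapWalk : ∀ {P Q x y} → (∀ {z} → P z → Q z) → Walk P x y → Walk Q x y
  mapWalk f (stop p)     = stop (f p)
  mapWalk f (step p a w) = step (f p) a (mapWalk f w)

  infixr 5 _◅◅_
  _◅◅_ : ∀ {P x y z} → Walk P x y → Walk P y z → Walk P x z
  stop _     ◅◅ w = w
  step p a v ◅◅ w = step p a (v ◅◅ w)

  snoc : ∀ {P x y z} → Walk P x y → y ~ z → P z → Walk P x z
  snoc w a p = w ◅◅ step (end w) a (stop p)

  reverse : ∀ {P x y} → Walk P x y → Walk P y x
  reverse (stop p)     = stop p
  reverse (step p a w) = snoc (reverse w) (adj-sym G a) p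

  -- Equips each vertex of the walk with the initial segment leading to it, so that a later
  -- `mapWalk` can use its connection to `x`.
  trace : ∀ {P x y} → Walk P x y → Walk (Walk P x) x y
  trace w = go (stop (start w)) w
    where
    go : ∀ {P o x y} → Walk P o x → Walk P x y → Walk (Walk P o) x y
    go pre (stop p)     = stop pre
    go pre (step p a w) = step pre a (go (snoc pre a (start w)) w)

  exit : ∀ {P Q : V → Set} (Q? : ∀ x → Dec (Q x)) {x y} → Walk P x y → Q x → ¬ Q y →
    ∃₂ λ u w → Walk (λ z → P z × Q z) x u × u ~ w × P w × ¬ Q w
  exit Q? (stop p) q ¬q = contradiction q ¬q
  exit Q? (step {x} {y} p a w) q ¬q with Q? y
  ... | no ¬qy = x , y , stop (p , q) , a , start w , ¬qy
  ... | yes qy = let u , v , w′ , rest = exit Q? w qy ¬q in u , v , step (p , q) a w′ , rest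

  enter : ∀ {P Q : V → Set} (Q? : ∀ x → Dec (Q x)) {x y} → Walk P x y → ¬ Q x → Q y →
    ∃₂ λ u w → Walk (λ z → P z × ¬ Q z) x u × u ~ w × P w × Q w
  enter Q? w ¬q q with exit (¬? ∘ Q?) w ¬q (λ ¬qy → ¬qy q)
  ... | u , v , w′ , a , p , ¬¬q = u , v , w′ , a , p , decidable-stable (Q? v) ¬¬q

  Reach⇒Walk : ∀ {x y} → Reach _~_ x y → Walk (λ _ → ⊤) x y
  Reach⇒Walk here              = stop tt
  Reach⇒Walk (step (inj₁ a) w) = step tt a (Reach⇒Walk w)
  Reach⇒Walk (step (inj₂ a) w) = step tt (adj-sym G a) (Reach⇒Walk w)

  module _ {P : V → Set} (P? : ∀ x → Dec (P x)) where

    -- Warshall's algorithm: the intermediate vertices are taken from the list.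
    Via : List V → V → V → Set
    Via []       x y = P x × P y × (x ≡ y ⊎ x ~ y)
    Via (v ∷ vs) x y = Via vs x y ⊎ (Via vs x v × Via vs v y)

    Via? : ∀ vs x y → Dec (Via vs x y)
    Via? []       x y = P? x ×-dec P? y ×-dec ((x Fin.≟ y) ⊎-dec adj-dec G x y)
    Via? (v ∷ vs) x y = Via? vs x y ⊎-dec (Via? vs x v ×-dec Via? vs v y)

    Via⇒Walk : ∀ vs {x y} → Via vs x y → Walk P x y
    Via⇒Walk []       (p , q , inj₁ refl) = stop p
    Via⇒Walk []       (p , q , inj₂ a)    = step p a (stop q)
    Via⇒Walk (v ∷ vs) (inj₁ w)            = Via⇒Walk vs w
    Via⇒Walk (v ∷ vs) (inj₂ (w , w′))     = Via⇒Walk vs w ◅◅ Via⇒Walk vs w′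

    Via-[] : ∀ vs {x y} → Via [] x y → Via vs x y
    Via-[] []       w = w
    Via-[] (v ∷ vs) w = inj₁ (Via-[] vs w)

    -- If both parts pass through the head of the list, the detour between these two passages, with
    -- `v` on it, is cut out.
    Via-trans : ∀ {vs x v y} → v ∈ vs → Via vs x v → Via vs v y → Via vs x y
    Via-trans (here refl) w w′ = inj₂ ([ id , proj₁ ]′ w , [ id , proj₂ ]′ w′)
    Via-trans (there i) (inj₁ w)       (inj₁ w′)       = inj₁ (Via-trans i w w′)
    Via-trans (there i) (inj₁ w)       (inj₂ (u , u′)) = inj₂ (Via-trans i w u , u′)
    Via-trans (there i) (inj₂ (u , u′)) (inj₁ w)       = inj₂ (u , Via-trans i u′ w)
    Via-trans (there i) (inj₂ (u , _)) (inj₂ (_ , u′)) = inj₂ (u , u′)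

    Walk⇒Via : ∀ {x y} → Walk P x y → Via (allFin _) x y
    Walk⇒Via (stop p)     = Via-[] (allFin _) (p , p , inj₁ refl)
    Walk⇒Via (step p a w) =
      Via-trans (∈-allFin _) (Via-[] (allFin _) (p , start w , inj₂ a)) (Walk⇒Via w)

    Walk? : ∀ x y → Dec (Walk P x y)
    Walk? x y = map′ (Via⇒Walk (allFin _)) Walk⇒Via (Via? (allFin _) x y)

  -- Parallel minors from maps with connected fibres

  -- The contracted edges are all those inside a fibre of `φ`; as the fibres are connected, they are
  -- the components.
  parallelMinor : ∀ {M} (φ : V → Fin (order M)) →
    (∀ a → ∃ λ x → φ x ≡ a) →
    (∀ {x y} → φ x ≡ φ y → Walk (λ z → φ z ≡ φ x) x y) →
    (∀ {a b} → Adj M a b → ∃₂ λ x y → φ x ≡ a × φ y ≡ b × x ~ y) →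
    (∀ {x y} → φ x ≢ φ y → x ~ y → Adj M (φ x) (φ y)) →
    ParallelMinor M G
  parallelMinor {M} φ surj fibre lift project = record
    { F        = λ x y → x ~ y × φ x ≡ φ y
    ; F⊆E      = proj₁
    ; φ        = φ
    ; φ-surj   = λ a → proj₁ (surj a) , λ { refl → proj₂ (surj a) }
    ; φ-fibres = λ x y → mk⇔ (λ eq → toReach (fibre eq)) constant
    ; φ-adj    = λ a b → mk⇔
        (λ e → (λ { refl → adj-irrefl M e }) , lift e)
        (λ { (a≢b , x , y , refl , refl , e) → project a≢b e })
    }
    where
    toReach : ∀ {i x y} → Walk (λ z → φ z ≡ i) x y → Reach (λ x y → x ~ y × φ x ≡ φ y) x y
    toReach (stop _)     = here
    toReach (step p a w) = step (inj₁ (a , trans p (sym (start w)))) (toReach w)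

    constant : ∀ {x y} → Reach (λ x y → x ~ y × φ x ≡ φ y) x y → φ x ≡ φ y
    constant here                    = refl
    constant (step (inj₁ (_ , e)) w) = trans e (constant w)
    constant (step (inj₂ (_ , e)) w) = trans (sym e) (constant w)

  -- The value `fzero` is reserved for everything outside `ys`, which becomes the hub.
  position : (ys : List V) → V → Fin (suc (length ys))
  position ys t with t ∈? ys
  ... | yes i = fsuc (index i)
  ... | no  _ = fzero

  position-suc : ∀ ys {t i} → position ys t ≡ fsuc i → t ≡ lookup ys i
  position-suc ys {t} eq with t ∈? ys | eq
  ... | yes i | refl = lookup-index i

  position-lookup : ∀ {ys} → Unique ys → ∀ i → position ys (lookup ys i) ≡ fsuc i
  position-lookup {ys} ys! i with lookup ys i ∈? ys
  ... | yes j = cong fsuc (sym (Unique⇒lookup-injective ys! (lookup-index j)))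
  ... | no ¬j = contradiction (∈-lookup i) ¬j

  position-∉ : ∀ {ys t} → t ∉ ys → position ys t ≡ fzero
  position-∉ {ys} {t} t∉ys with t ∈? ys
  ... | yes i = contradiction i t∉ys
  ... | no  _ = refl

  -- Stars and complete graphs from a connected set with many neighbours

  module Hub
    (connected : Connected G)
    {C : V → Set} (c : V) (c∈C : C c) (C-connected : ∀ {x} → C x → Walk C x c)
    {xs : List V} (xs! : Unique xs) (xs-near : ∀ {x} → x ∈ xs → ¬ C x × ∃ λ u → x ~ u × C u)
    where

    terminals : List V
    terminals = c ∷ xs

    Free : V → V → Set
    Free t z = z ∉ terminals ⊎ z ≡ t

    Free? : ∀ t z → Dec (Free t z)
    Free? t z = ¬? (z ∈? terminals) ⊎-dec (z Fin.≟ t)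

    Sees : V → V → Set
    Sees x t = Walk (Free t) x t

    Sees? : ∀ x t → Dec (Sees x t)
    Sees? x t = Walk? (Free? t) x t

    -- Among the terminals that can be reached without meeting another one, the first in the list is
    -- chosen. With `c` at the head, all of `C` falls into the cell of `c`; adjacent non-terminals
    -- see the same terminals and so share a cell.
    cell : V → V
    cell x = first (Sees? x) c terminals

    sees-some : ∀ x → Any (Sees x) terminals
    sees-some x with x ∈? terminals
    ... | yes i = Any-stop i
      where
      Any-stop : ∀ {ts} → x ∈ ts → Any (Sees x) ts
      Any-stop (here refl) = here (stop (inj₂ refl))
      Any-stop (there i)   = there (Any-stop i)
    -- The first terminal on a walk to `c` is seen by `x`.
    ... | no x∉ with enter (_∈? terminals) (Reach⇒Walk (connected x c)) x∉ (here refl)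
    ...   | u , w , W , u~w , _ , w∈ = Any-sees w∈
      where
      Any-sees : ∀ {ts} → w ∈ ts → Any (Sees x) ts
      Any-sees (here refl) = here (snoc (mapWalk (inj₁ ∘ proj₂) W) u~w (inj₂ refl))
      Any-sees (there i)   = there (Any-sees i)

    cell-∈ : ∀ x → cell x ∈ terminals
    cell-∈ x = proj₁ (first-satisfies (Sees? x) c (sees-some x))

    sees-cell : ∀ x → Sees x (cell x)
    sees-cell x = proj₂ (first-satisfies (Sees? x) c (sees-some x))

    cell-terminal : ∀ {t} → t ∈ terminals → cell t ≡ t
    cell-terminal {t} t∈ with start (sees-cell t)
    ... | inj₁ t∉ = contradiction t∈ t∉
    ... | inj₂ eq = sym eq

    cell-step : ∀ {x y} → x ∉ terminals → y ∉ terminals → x ~ y → cell x ≡ cell y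
    cell-step {x} {y} x∉ y∉ x~y = first-cong (Sees? x) c (Sees? y)
      (step (inj₁ y∉) (adj-sym G x~y)) (step (inj₁ x∉) x~y) terminals

    -- The walk that witnesses `Sees` stays in the cell, since by `cell-step` the cell does not
    -- change before a terminal is met.
    cell-connected : ∀ x → Walk (λ z → cell z ≡ cell x) x (cell x)
    cell-connected x = go (sees-cell x) refl
      where
      t = cell x
      go : ∀ {z} → Walk (Free t) z t → cell z ≡ t → Walk (λ z → cell z ≡ t) z t
      go (stop _) e = stop e
      go (step (inj₂ refl) a w) e = stop e
      go (step (inj₁ z∉) a w) e with start w
      ... | inj₂ refl = step e a (stop (cell-terminal (cell-∈ x)))
      ... | inj₁ y∉   = step e a (go w (trans (sym (cell-step z∉ y∉ a)) e))

    cell-C : ∀ {x} → C x → cell x ≡ c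
    cell-C Cx = first-head (Sees? _) c (mapWalk free (C-connected Cx))
      where
      free : ∀ {z} → C z → Free c z
      free {z} Cz with z Fin.≟ c
      ... | yes z≡c = inj₂ z≡c
      ... | no  z≢c = inj₁ λ { (here e) → z≢c e ; (there i) → proj₁ (xs-near i) Cz }

    Joined : V → V → Set
    Joined s t = ∃₂ λ x y → cell x ≡ s × cell y ≡ t × x ~ y

    Joined? : ∀ s t → Dec (Joined s t)
    Joined? s t = Fin.any? λ x → Fin.any? λ y →
      (cell x Fin.≟ s) ×-dec (cell y Fin.≟ t) ×-dec adj-dec G x y

    Joined-sym : Symmetric Joined
    Joined-sym (x , y , ex , ey , a) = y , x , ey , ex , adj-sym G a

    module _ {ys : List V} (ys⊆xs : ∀ {y} → y ∈ ys → y ∈ xs) (ys! : Unique ys) where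

      φ : V → Fin (suc (length ys))
      φ x = position ys (cell x)

      root : Fin (suc (length ys)) → V
      root fzero    = c
      root (fsuc i) = lookup ys i

      φ-C : ∀ {x} → C x → φ x ≡ fzero
      φ-C Cx = trans (cong (position ys) (cell-C Cx)) (position-∉ (λ i → proj₁ (xs-near (ys⊆xs i)) c∈C))

      φ-root : ∀ a → φ (root a) ≡ a
      φ-root fzero    = φ-C c∈C
      φ-root (fsuc i) = trans (cong (position ys) (cell-terminal (there (ys⊆xs (∈-lookup i)))))
                              (position-lookup ys! i)

      to-cell : ∀ x → Walk (λ z → φ z ≡ φ x) x (cell x)
      to-cell x = mapWalk (cong (position ys)) (cell-connected x)

      -- In the fibre of `fzero`, a terminal other than `c` still has a neighbour in `C`, which lies
      -- in the same fibre and leads to `c`.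
      to-root : ∀ {x a} → φ x ≡ a → Walk (λ z → φ z ≡ a) x (root a)
      to-root {x} {fsuc i} eq =
        subst (Walk _ x) (position-suc ys eq) (mapWalk (λ e → trans e eq) (to-cell x))
      to-root {x} {fzero} eq with mapWalk (λ e → trans e eq) (to-cell x) | cell-∈ x
      ... | w | here e  = subst (Walk _ x) e w
      ... | w | there i = let _ , u , t~u , Cu = xs-near i in
                          w ◅◅ step (end w) t~u (mapWalk φ-C (C-connected Cu))

      fibre : ∀ {x y} → φ x ≡ φ y → Walk (λ z → φ z ≡ φ x) x y
      fibre eq = to-root refl ◅◅ reverse (to-root (sym eq))

      spoke : ∀ i → ∃₂ λ x y → φ x ≡ fzero × φ y ≡ fsuc i × x ~ y
      spoke i with xs-near (ys⊆xs (∈-lookup i))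
      ... | _ , u , t~u , Cu = u , lookup ys i , φ-C Cu , φ-root (fsuc i) , adj-sym G t~u

      joined : ∀ {x y i j} → φ x ≡ fsuc i → φ y ≡ fsuc j → x ~ y → Joined (lookup ys i) (lookup ys j)
      joined ex ey a = _ , _ , position-suc ys ex , position-suc ys ey , a

      star : AllPairs (λ s t → ¬ Joined s t) ys → ParallelMinor (Star (length ys)) G
      star ind = parallelMinor φ (λ a → root a , φ-root a) fibre lift project
        where
        lift : ∀ {a b} → Adj (Star (length ys)) a b → ∃₂ λ x y → φ x ≡ a × φ y ≡ b × x ~ y
        lift {b = fzero}  (inj₁ (refl , b≢0)) = contradiction refl b≢0
        lift {b = fsuc j} (inj₁ (refl , _))   = spoke j
        lift {a = fzero}  (inj₂ (refl , a≢0)) = contradiction refl a≢0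
        lift {a = fsuc i} (inj₂ (refl , _))   =
          let x , y , ex , ey , e = spoke i in y , x , ey , ex , adj-sym G e

        project : ∀ {x y} → φ x ≢ φ y → x ~ y → Adj (Star (length ys)) (φ x) (φ y)
        project {x} {y} ne a with φ x in ex | φ y in ey
        ... | fzero  | fzero  = contradiction refl ne
        ... | fzero  | fsuc j = inj₁ (refl , λ ())
        ... | fsuc i | fzero  = inj₂ (refl , λ ())
        ... | fsuc i | fsuc j = contradiction (joined ex ey a)
          (AllPairs-lookup (λ ¬j → ¬j ∘ Joined-sym) ind (ne ∘ cong fsuc))

      complete : AllPairs Joined ys → ParallelMinor (Complete (suc (length ys))) G
      complete cl = parallelMinor φ (λ a → root a , φ-root a) fibre lift (λ ne _ → ne)
        where
        lift : ∀ {a b} → a ≢ b → ∃₂ λ x y → φ x ≡ a × φ y ≡ b × x ~ y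
        lift {fzero}  {fzero}  ne = contradiction refl ne
        lift {fzero}  {fsuc j} ne = spoke j
        lift {fsuc i} {fzero}  ne = let x , y , ex , ey , e = spoke i in y , x , ey , ex , adj-sym G e
        lift {fsuc i} {fsuc j} ne =
          let x , y , ex , ey , e = AllPairs-lookup Joined-sym cl (ne ∘ cong fsuc) in
          x , y , trans (cong (position ys) ex) (position-lookup ys! i) ,
          trans (cong (position ys) ey) (position-lookup ys! j) , e

    -- By `spoke` the hub is adjacent to every chosen cell, so `a` pairwise joined cells yield a
    -- complete graph on `suc a` vertices.
    star-or-complete : ∀ a b → ramsey a b ≤ length xs →
      ParallelMinor (Star b) G ⊎ ParallelMinor (Complete (suc a)) G
    star-or-complete a b le with ramsey-theorem Joined? a b xs! le
    ... | ys , ys⊆xs , ys! , inj₁ (refl , cl)  = inj₂ (complete ys⊆xs ys! cl)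
    ... | ys , ys⊆xs , ys! , inj₂ (refl , ind) = inj₁ (star ys⊆xs ys! ind)

  -- Cycles and paths from a level function

  module Levels
    {K : ℕ} (lev : V → ℕ) (lev≤K : ∀ x → lev x ≤ K)
    (occupied : ∀ {r} → r ≤ K → ∃ λ x → lev x ≡ r)
    (level-connected : ∀ {x y} → lev x ≡ lev y → Walk (λ z → lev z ≡ lev x) x y)
    (consecutive : ∀ {r} → r < K → ∃₂ λ x y → lev x ≡ r × lev y ≡ suc r × x ~ y)
    (no-jump : ∀ {x y} → x ~ y → lev x < lev y → suc (lev x) ≡ lev y ⊎ (lev x ≡ 0 × lev y ≡ K))
    where

    φ : V → Fin (suc K)
    φ x = fromℕ< (s≤s (lev≤K x))

    toℕ-φ : ∀ x → toℕ (φ x) ≡ lev x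
    toℕ-φ x = Fin.toℕ-fromℕ< (s≤s (lev≤K x))

    φ-lev : ∀ {x a} → lev x ≡ toℕ a → φ x ≡ a
    φ-lev e = Fin.toℕ-injective (trans (toℕ-φ _) e)

    φ-≡ : ∀ {x y} → lev x ≡ lev y → φ x ≡ φ y
    φ-≡ e = φ-lev (trans e (sym (toℕ-φ _)))

    lev-≡ : ∀ {x y} → φ x ≡ φ y → lev x ≡ lev y
    lev-≡ e = trans (sym (toℕ-φ _)) (trans (cong toℕ e) (toℕ-φ _))

    φ-surj : ∀ a → ∃ λ x → φ x ≡ a
    φ-surj a = let x , e = occupied (Fin.toℕ≤pred[n] a) in x , φ-lev e

    φ-fibre : ∀ {x y} → φ x ≡ φ y → Walk (λ z → φ z ≡ φ x) x y
    φ-fibre e = mapWalk φ-≡ (level-connected (lev-≡ e))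

    φ-consecutive : ∀ {a b} → suc (toℕ a) ≡ toℕ b → ∃₂ λ x y → φ x ≡ a × φ y ≡ b × x ~ y
    φ-consecutive {a} {b} e =
      let x , y , ex , ey , x~y = consecutive (subst (_≤ _) (sym e) (Fin.toℕ≤pred[n] b))
      in x , y , φ-lev ex , φ-lev (trans ey e) , x~y

    φ-jump : ∀ {x y} → φ x ≢ φ y → x ~ y →
      (suc (toℕ (φ x)) ≡ toℕ (φ y) ⊎ (toℕ (φ x) ≡ 0 × toℕ (φ y) ≡ K)) ⊎
      (suc (toℕ (φ y)) ≡ toℕ (φ x) ⊎ (toℕ (φ y) ≡ 0 × toℕ (φ x) ≡ K))
    φ-jump {x} {y} ne a rewrite toℕ-φ x | toℕ-φ y with <-cmp (lev x) (lev y)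
    ... | tri< lt _ _ = inj₁ (no-jump a lt)
    ... | tri≈ _ eq _ = contradiction (φ-≡ eq) ne
    ... | tri> _ _ gt = inj₂ (no-jump (adj-sym G a) gt)

    -- By `no-jump`, an edge between the extreme levels is the only possible obstacle to the
    -- quotient being a path.
    Closing : Set
    Closing = ∃₂ λ x y → x ~ y × lev x ≡ 0 × lev y ≡ K

    Closing? : Dec Closing
    Closing? = Fin.any? λ x → Fin.any? λ y → adj-dec G x y ×-dec (lev x ≟ 0) ×-dec (lev y ≟ K)

    swapped : ∀ {a b} → (∃₂ λ x y → φ x ≡ a × φ y ≡ b × x ~ y) → ∃₂ λ x y → φ x ≡ b × φ y ≡ a × x ~ y
    swapped (x , y , ex , ey , e) = y , x , ey , ex , adj-sym G e

    cycle : Closing → ParallelMinor (Cycle (suc K)) G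
    cycle (x₀ , y₀ , e₀ , x₀≡0 , y₀≡K) = parallelMinor φ φ-surj φ-fibre lift project
      where
      lift′ : ∀ {a b} → Succ (suc K) a b → ∃₂ λ x y → φ x ≡ a × φ y ≡ b × x ~ y
      lift′ (inj₁ e)       = φ-consecutive e
      lift′ (inj₂ (e , z)) =
        y₀ , x₀ , φ-lev (trans y₀≡K (sym (suc-injective e))) , φ-lev (trans x₀≡0 (sym z)) , adj-sym G e₀

      lift : ∀ {a b} → Adj (Cycle (suc K)) a b → ∃₂ λ x y → φ x ≡ a × φ y ≡ b × x ~ y
      lift (_ , inj₁ s) = lift′ s
      lift (_ , inj₂ s) = swapped (lift′ s)

      project : ∀ {x y} → φ x ≢ φ y → x ~ y → Adj (Cycle (suc K)) (φ x) (φ y)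
      project ne a with φ-jump ne a
      ... | inj₁ (inj₁ e)       = ne , inj₁ (inj₁ e)
      ... | inj₁ (inj₂ (z , e)) = ne , inj₂ (inj₂ (cong suc e , z))
      ... | inj₂ (inj₁ e)       = ne , inj₂ (inj₁ e)
      ... | inj₂ (inj₂ (z , e)) = ne , inj₁ (inj₂ (cong suc e , z))

    path : ¬ Closing → ParallelMinor (Path (suc K)) G
    path ¬closing = parallelMinor φ φ-surj φ-fibre lift project
      where
      lift : ∀ {a b} → Adj (Path (suc K)) a b → ∃₂ λ x y → φ x ≡ a × φ y ≡ b × x ~ y
      lift (inj₁ e) = φ-consecutive e
      lift (inj₂ e) = swapped (φ-consecutive e)

      closing : ∀ {x y} → x ~ y → toℕ (φ x) ≡ 0 → toℕ (φ y) ≡ K → Closing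
      closing a z e = _ , _ , a , trans (sym (toℕ-φ _)) z , trans (sym (toℕ-φ _)) e

      project : ∀ {x y} → φ x ≢ φ y → x ~ y → Adj (Path (suc K)) (φ x) (φ y)
      project ne a with φ-jump ne a
      ... | inj₁ (inj₁ e)       = inj₁ e
      ... | inj₁ (inj₂ (z , e)) = contradiction (closing a z e) ¬closing
      ... | inj₂ (inj₁ e)       = inj₂ e
      ... | inj₂ (inj₂ (z , e)) = contradiction (closing (adj-sym G a) z e) ¬closing

    cycle-or-path : ParallelMinor (Cycle (suc K)) G ⊎ ParallelMinor (Path (suc K)) G
    cycle-or-path with Closing?
    ... | yes c = inj₁ (cycle c)
    ... | no ¬c = inj₂ (path ¬c)

  -- Chains, their slabs and restriction to a component of a slab

  module _ (v p : V) where

    -- Vertices of `A m` do not count: after a restriction the last set may be adjacent to discarded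
    -- components, which must not add to the width.
    Frontier : (ℕ → V → Set) → ℕ → ℕ → V → Set
    Frontier A m t y = A t y × ¬ A m y × ∃ λ u → y ~ u × ¬ A t u

    -- Only edges between the complement of A 0 and A m may skip a slab A t ∖ A (suc t).
    record Chain (m w : ℕ) : Set₁ where
      field
        A       : ℕ → V → Set
        A?      : ∀ t x → Dec (A t x)
        A-anti  : ∀ {t x} → A (suc t) x → A t x
        p∈      : A m p
        v∉      : ¬ A 0 v
        inside  : ∀ {t x} → A t x → Walk (A t) x p
        outside : ∀ {t x} → t ≤ m → ¬ A t x → Walk (¬_ ∘ A t) x v
        tight   : ∀ {t x y} → t < m → ¬ A t x → A (suc t) y → x ~ y → ¬ A 0 x × A m y
        proper  : ∃ λ x → A 0 x × ¬ A m x
        narrow  : ∀ {t} → t < m → ∀ {xs} → Unique xs → All (Frontier A m t) xs → length xs < w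

    module _ {m w : ℕ} (𝒞 : Chain m w) where
      open Chain 𝒞

      A-anti* : ∀ {s t x} → s ≤ t → A t x → A s x
      A-anti* {s} {t} {x} s≤t = go (≤⇒≤′ s≤t)
        where
        go : ∀ {t} → s ≤′ t → A t x → A s x
        go (≤′-reflexive refl) a = a
        go (≤′-step le)        a = go le (A-anti a)

      -- From the vertex given by `proper`, either a walk to `v` avoiding `A m` or a walk to `p`
      -- inside `A 0` crosses the boundary of `A (suc t)`. The outer end of the crossing edge lies
      -- in `A t`: otherwise `tight` would place the edge between the outside of `A 0` and `A m`.
      level-inhabited : ∀ {t} → t < m → ∃ λ x → A t x × ¬ A (suc t) x
      level-inhabited {t} t<m with proper
      ... | x , x∈ , x∉ with A? (suc t) x
      ... | yes x∈t with exit (A? (suc t)) (outside ≤-refl x∉) x∈t (v∉ ∘ A-anti* z≤n)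
      ...   | u , w , W , u~w , w∉m , w∉ with A? t w
      ...     | yes w∈ = w , w∈ , w∉
      ...     | no w∉t = let (u∉m , u∈) = end W in
                contradiction (proj₂ (tight t<m w∉t u∈ (adj-sym G u~w))) u∉m
      level-inhabited {t} t<m
          | x , x∈ , x∉ | no x∉t with enter (A? (suc t)) (inside x∈) x∉t (A-anti* t<m p∈)
      ...   | u , w , W , u~w , _ , w∈ with end W | A? t u
      ...     | u∈0 , u∉ | yes u∈ = u , u∈ , u∉
      ...     | u∈0 , u∉ | no u∉t = contradiction u∈0 (proj₁ (tight t<m u∉t w∈ u~w))

      Slab : ℕ → ℕ → V → Set
      Slab i j x = A i x × ¬ A j x

      Slab? : ∀ i j x → Dec (Slab i j x)
      Slab? i j x = A? i x ×-dec ¬? (A? j x)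

      slab-inhabited : ∀ {i j} → i < j → j ≤ m → ∃ λ x → Slab i j x
      slab-inhabited i<j j≤m = let x , x∈ , x∉ = level-inhabited (<-≤-trans i<j j≤m) in
        x , x∈ , x∉ ∘ A-anti* i<j

      Separated : ℕ → ℕ → Set
      Separated i j = ∃₂ λ x y → Slab i j x × Slab i j y × ¬ Walk (Slab i j) x y

      separated? : ∀ i j → Dec (Separated i j)
      separated? i j = Fin.any? λ x → Fin.any? λ y →
        Slab? i j x ×-dec Slab? i j y ×-dec ¬? (Walk? (Slab? i j) x y)

    -- X is a component of the slab.  Every other component spans the slab as well and therefore
    -- meets the frontier of every level, so that restricting to X lowers the width.
    module Restrict {m w : ℕ} (𝒞 : Chain m (suc w)) (i s : ℕ) (bound : s + i ≤ m)
      {x₀ y₀ : V} (x₀∈ : Slab 𝒞 i (s + i) x₀) (y₀∈ : Slab 𝒞 i (s + i) y₀)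
      (separated : ¬ Walk (Slab 𝒞 i (s + i)) x₀ y₀) where

      open Chain 𝒞

      S X : V → Set
      S = Slab 𝒞 i (s + i)
      X = Walk S x₀

      anti : ∀ {s t x} → s ≤ t → A t x → A s x
      anti = A-anti* 𝒞

      -- `A (s + i)` is kept whole at every level, while the other components of the slab fall to
      -- the side of `v`.
      A′ : ℕ → V → Set
      A′ t x = (X x × A (t + i) x) ⊎ A (s + i) x

      A′-end : ∀ {x} → A′ s x → A (s + i) x
      A′-end (inj₁ (_ , a)) = a
      A′-end (inj₂ a)       = a

      A′⊆ : ∀ {t x} → t ≤ s → A′ t x → A (t + i) x
      A′⊆ t≤s (inj₁ (_ , a)) = a
      A′⊆ t≤s (inj₂ a)       = anti (+-monoˡ-≤ i t≤s) a

      X-step : ∀ {x y} → X x → x ~ y → S y → X y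
      X-step = snoc

      -- Until a walk to `p` in `A (t + i)` enters `A (s + i)`, it stays in the slab and hence in
      -- `X`.
      inside′ : ∀ {t x} → A′ t x → Walk (A′ t) x p
      inside′ (inj₂ a) = mapWalk inj₂ (inside a)
      inside′ {t} (inj₁ (Xx , a))
        with enter (A? (s + i)) (inside a) (proj₂ (end Xx)) (anti bound p∈)
      ... | u , w , W , u~w , _ , w∈ =
        mapWalk (λ W′ → inj₁ (Xx ◅◅ mapWalk slab W′ , proj₁ (end W′))) (trace W)
          ◅◅ step (inj₁ (Xx ◅◅ mapWalk slab W , proj₁ (end W))) u~w (mapWalk inj₂ (inside w∈))
        where
        slab : ∀ {z} → A (t + i) z × ¬ A (s + i) z → S z
        slab (a , ¬a) = anti (m≤n+m i t) a , ¬a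

      -- Outside `A i` or in `X` the old walk to `v` serves. From another component, a walk avoiding
      -- `A (s + i)` stays in that component until it leaves `A i`, and so misses `X`.
      outside′ : ∀ {t x} → t ≤ s → ¬ A′ t x → Walk (¬_ ∘ A′ t) x v
      outside′ {t} {x} t≤s x∉ with A? i x | Walk? (Slab? 𝒞 i (s + i)) x₀ x
      ... | no x∉i | _ = mapWalk (_∘ anti (m≤n+m i t) ∘ A′⊆ t≤s)
                           (outside (≤-trans (m≤n+m i s) bound) x∉i)
      ... | yes x∈i | yes Xx = mapWalk (_∘ A′⊆ t≤s)
                           (outside (≤-trans (+-monoˡ-≤ i t≤s) bound) (λ a → x∉ (inj₁ (Xx , a))))
      ... | yes x∈i | no ¬Xx
        with exit (A? i) (outside bound (x∉ ∘ inj₂)) x∈i (v∉ ∘ anti z≤n)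
      ...   | u , w , W , u~w , _ , w∉i =
        mapWalk avoid (trace W)
          ◅◅ step (avoid W) u~w
            (mapWalk (_∘ anti (m≤n+m i t) ∘ A′⊆ t≤s) (outside (≤-trans (m≤n+m i s) bound) w∉i))
        where
        avoid : ∀ {z} → Walk (λ z → ¬ A (s + i) z × A i z) x z → ¬ A′ t z
        avoid W (inj₁ (Xz , _)) = ¬Xx (Xz ◅◅ reverse (mapWalk (λ (¬a , a) → a , ¬a) W))
        avoid W (inj₂ a)        = proj₁ (end W) a

      -- If `y` is in `A (s + i)`, the old `tight` keeps `x` out of `X`. If `y` is in `X`, then `x`
      -- is in `X` too or the edge skips an old slab and ends in `A m`; both are impossible.
      tight′ : ∀ {t x y} → t < s → ¬ A′ t x → A′ (suc t) y → x ~ y → ¬ A′ 0 x × A′ s y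
      tight′ {t} {x} {y} t<s x∉ (inj₂ y∈) x~y = x∉0 , inj₂ y∈
        where
        x∉0 : ¬ A′ 0 x
        x∉0 (inj₂ a)        = x∉ (inj₂ a)
        x∉0 (inj₁ (Xx , a)) = proj₁ (tight (≤-trans (+-monoˡ-≤ i t<s) bound)
          (λ a′ → x∉ (inj₁ (Xx , a′))) (anti (+-monoˡ-≤ i t<s) y∈) x~y) (anti z≤n a)
      tight′ {t} {x} {y} t<s x∉ (inj₁ (Xy , y∈)) x~y with A? (t + i) x
      ... | yes a = contradiction (inj₁ (X-step Xy (adj-sym G x~y) (anti (m≤n+m i t) a , x∉ ∘ inj₂) , a)) x∉
      ... | no ¬a = contradiction
        (anti bound (proj₂ (tight (≤-trans (+-monoˡ-≤ i t<s) bound) ¬a y∈ x~y))) (proj₂ (end Xy))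

      -- If the outer neighbour `u` were in `A (t + i)`, it would lie in the slab, hence in `X` with
      -- `y`, and so in `A′ t`.
      frontier-X : ∀ {t y} → Frontier A′ s t y → Frontier A m (t + i) y × X y
      frontier-X (inj₂ a , y∉ , _) = contradiction (inj₂ a) y∉
      frontier-X {t} (inj₁ (Xy , a) , y∉ , u , y~u , u∉) =
        (a , y∉ ∘ inj₂ ∘ anti bound , u , y~u , u∉t) , Xy
        where
        u∉t : ¬ A (t + i) u
        u∉t b = u∉ (inj₁ (X-step Xy y~u (anti (m≤n+m i t) b , u∉ ∘ inj₂) , b))

      -- From `y₀` walk inside `A i` up to the edge entering `A (s + i)`; its outer end is in
      -- `A (t + i)` by `tight`. Then walk towards `v` until about to leave `A (t + i)`. All this
      -- happens in the component of `y₀`.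
      frontier-other : ∀ {t} → t < s → ∃ λ y → Frontier A m (t + i) y × ¬ X y
      frontier-other {t} t<s
        with enter (A? (s + i)) (inside (proj₁ y₀∈)) (proj₂ y₀∈) (anti bound p∈)
      ... | z , w , W , z~w , _ , w∈ with end W
      ... | z∈i , z∉ with A? (t + i) z
      ... | no z∉t = contradiction (anti z≤n z∈i)
                       (proj₁ (tight (≤-trans (+-monoˡ-≤ i t<s) bound) z∉t (anti (+-monoˡ-≤ i t<s) w∈) z~w))
      ... | yes z∈t with exit (A? (t + i)) (outside bound z∉) z∈t (v∉ ∘ anti z≤n)
      ... | y , u , W′ , y~u , _ , u∉ with end W′
      ... | y∉ , y∈ = y , (y∈ , y∉ ∘ anti bound , u , y~u , u∉) , λ Xy → separated
              (Xy ◅◅ reverse (W ◅◅ mapWalk (λ (¬a , a) → anti (m≤n+m i t) a , ¬a) W′))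

      narrow′ : ∀ {t} → t < s → ∀ {xs} → Unique xs → All (Frontier A′ s t) xs → length xs < w
      narrow′ t<s xs! fr =
        let y , fry , ¬Xy = frontier-other t<s in
        ≤-pred (narrow (≤-trans (+-monoˡ-≤ i t<s) bound)
          (All.map (λ f → λ { refl → ¬Xy (proj₂ (frontier-X f)) }) fr ∷ xs!)
          (fry ∷ All.map (proj₁ ∘ frontier-X) fr))

      restricted : Chain s w
      restricted = record
        { A       = A′
        ; A?      = λ t x → (Walk? (Slab? 𝒞 i (s + i)) x₀ x ×-dec A? (t + i) x) ⊎-dec A? (s + i) x
        ; A-anti  = Sum.map₁ (λ (Xx , a) → Xx , A-anti a)
        ; p∈      = inj₂ (anti bound p∈)
        ; v∉      = v∉ ∘ anti z≤n ∘ A′⊆ z≤n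
        ; inside  = inside′
        ; outside = outside′
        ; tight   = tight′
        ; proper  = x₀ , inj₁ (stop x₀∈ , proj₁ x₀∈) , proj₂ x₀∈ ∘ A′-end
        ; narrow  = narrow′
        }

    -- From chains to cycles and paths

    module _ (connected : Connected G) where

      module ConnectedSlabs {K s w : ℕ} (1≤s : 1 ≤ s) (𝒞 : Chain (suc K * s) w)
        (slab-connected : ∀ {r x y} → r < suc K → Slab 𝒞 (r * s) (suc r * s) x → Slab 𝒞 (r * s) (suc r * s) y →
                          Walk (Slab 𝒞 (r * s) (suc r * s)) x y)
        where

        open Chain 𝒞

        anti : ∀ {s t x} → s ≤ t → A t x → A s x
        anti = A-anti* 𝒞

        top : ℕ → V → ℕ
        top zero    x = 0
        top (suc r) x with A? (suc r * s) x
        ... | yes _ = suc r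
        ... | no  _ = top r x

        top≤ : ∀ r x → top r x ≤ r
        top≤ zero    x = z≤n
        top≤ (suc r) x with A? (suc r * s) x
        ... | yes _ = ≤-refl
        ... | no  _ = m≤n⇒m≤1+n (top≤ r x)

        top-A : ∀ R {r x} → 1 ≤ r → r ≤ top R x → A (r * s) x
        top-A zero    1≤r r≤ = contradiction (≤-trans 1≤r r≤) λ ()
        top-A (suc R) {r} {x} 1≤r r≤ with A? (suc R * s) x
        ... | yes a = anti (*-monoˡ-≤ s r≤) a
        ... | no  _ = top-A R 1≤r r≤

        A-top : ∀ R {r x} → r ≤ R → A (r * s) x → r ≤ top R x
        A-top zero    z≤n a = z≤n
        A-top (suc R) {r} {x} r≤ a with A? (suc R * s) x
        ... | yes _ = r≤
        ... | no ¬a = A-top R (≤-pred (≤∧≢⇒< r≤ λ { refl → ¬a a })) a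

        -- Level 0 also takes the vertices outside `A 0`, and level `K` those of the last set: the
        -- sides of `v` and `p` join the extreme slabs.
        lev : V → ℕ
        lev = top K

        lev-slab : ∀ {r x} → r ≤ K → Slab 𝒞 (r * s) (suc r * s) x → lev x ≡ r
        lev-slab r≤K (a , ¬a) = ≤-antisym (≮⇒≥ λ lt → ¬a (top-A K (s≤s z≤n) lt)) (A-top K r≤K a)

        lev-<⇒∉ : ∀ {r x} → r ≤ K → lev x < r → ¬ A (r * s) x
        lev-<⇒∉ r≤K lt a = <⇒≱ lt (A-top K r≤K a)

        multiple≤ : ∀ {r} → r ≤ K → suc r * s ≤ suc K * s
        multiple≤ r≤K = *-monoˡ-≤ s (s≤s r≤K)

        multiple< : ∀ r → r * s < suc r * s
        multiple< r = m<n+m (r * s) 1≤s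

        no-long-jump : ∀ {r t x y} → r < t → t ≤ suc K → ¬ A (r * s) x → A (t * s) y → x ~ y →
          ¬ A 0 x × A (suc K * s) y
        no-long-jump {r} r<t t≤ x∉ y∈ = tight (<-≤-trans (multiple< r) (*-monoˡ-≤ s (≤-trans r<t t≤))) x∉
          (anti (<-≤-trans (multiple< r) (*-monoˡ-≤ s r<t)) y∈)

        occupied : ∀ {r} → r ≤ K → ∃ λ x → lev x ≡ r
        occupied {r} r≤K = let x , x∈ = slab-inhabited 𝒞 (multiple< r) (multiple≤ r≤K) in x , lev-slab r≤K x∈

        -- For `K = 0` the only level is all of `V`. Otherwise level 0 is the complement of
        -- `A (1 * s)`, connected through `v`, and level `K` is `A (K * s)`, connected through `p`;
        -- the levels between are slabs.
        level-connected : ∀ {x y} → lev x ≡ lev y → Walk (λ z → lev z ≡ lev x) x y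
        level-connected {x} {y} eq with lev x in ex | lev y in ey
        level-connected {x} {y} refl | zero | zero with K ≟ 0
        ... | yes refl = mapWalk (λ _ → refl) (Reach⇒Walk (connected x y))
        ... | no K≢0   = mapWalk low (to-v ex) ◅◅ reverse (mapWalk low (to-v ey))
          where
          1≤K : 1 ≤ K
          1≤K = n≢0⇒n>0 K≢0
          low : ∀ {z} → ¬ A (1 * s) z → lev z ≡ 0
          low z∉ = n≤0⇒n≡0 (≮⇒≥ λ lt → z∉ (top-A K ≤-refl lt))
          to-v : ∀ {z} → lev z ≡ 0 → Walk (¬_ ∘ A (1 * s)) z v
          to-v e = outside (multiple≤ {0} z≤n) (lev-<⇒∉ 1≤K (s≤s (≤-reflexive e)))
        level-connected {x} {y} refl | suc r | suc r with K ≟ suc r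
        ... | yes K≡ = mapWalk high (to-p ex) ◅◅ reverse (mapWalk high (to-p ey))
          where
          high : ∀ {z} → A (suc r * s) z → lev z ≡ suc r
          high {z} a = ≤-antisym (≤-trans (top≤ K z) (≤-reflexive K≡)) (A-top K (≤-reflexive (sym K≡)) a)
          to-p : ∀ {z} → lev z ≡ suc r → Walk (A (suc r * s)) z p
          to-p e = inside (top-A K (s≤s z≤n) (≤-reflexive (sym e)))
        ... | no K≢ = mapWalk (lev-slab r<K) (slab-connected (s≤s r<K) (mid ex) (mid ey))
          where
          r<K : suc r ≤ K
          r<K = subst (_≤ K) ex (top≤ K x)
          mid : ∀ {z} → lev z ≡ suc r → Slab 𝒞 (suc r * s) (suc (suc r) * s) z
          mid e = top-A K (s≤s z≤n) (≤-reflexive (sym e)) ,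
                  lev-<⇒∉ (≤∧≢⇒< r<K (K≢ ∘ sym)) (s≤s (≤-reflexive e))

        -- A walk to `p` from slab `r` must enter the next set. It cannot jump past the next slab on
        -- that edge, whose outer end is in `A 0`.
        consecutive : ∀ {r} → r < K → ∃₂ λ x y → lev x ≡ r × lev y ≡ suc r × x ~ y
        consecutive {r} r<K with slab-inhabited 𝒞 (multiple< r) (multiple≤ (<⇒≤ r<K))
        ... | z , z∈ , z∉ with enter (A? (suc r * s)) (inside z∈) z∉ (anti (multiple≤ (<⇒≤ r<K)) p∈)
        ... | u , w , W , u~w , _ , w∈ with end W
        ... | u∈ , u∉ = u , w , lev-slab (<⇒≤ r<K) (u∈ , u∉) , lev-slab r<K (w∈ , w∉) , u~w
          where
          w∉ : ¬ A (suc (suc r) * s) w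
          w∉ a = proj₁ (no-long-jump ≤-refl (s≤s r<K) u∉ a u~w) (anti z≤n u∈)

        no-jump : ∀ {x y} → x ~ y → lev x < lev y → suc (lev x) ≡ lev y ⊎ (lev x ≡ 0 × lev y ≡ K)
        no-jump {x} {y} x~y lt with suc (lev x) ≟ lev y
        ... | yes e = inj₁ e
        -- An edge that skips a level is one of the exceptions in `tight`, from outside `A 0` to the
        -- last set.
        ... | no ≢ with no-long-jump (≤∧≢⇒< lt ≢) (m≤n⇒m≤1+n (top≤ K y))
                          (lev-<⇒∉ (≤-trans lt (top≤ K y)) ≤-refl)
                          (top-A K (≤-trans (s≤s z≤n) lt) ≤-refl) x~y
        ... | x∉ , y∈ = inj₂
          ( n≤0⇒n≡0 (≮⇒≥ λ lt → x∉ (anti z≤n (top-A K ≤-refl lt)))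
          , ≤-antisym (top≤ K y) (A-top K ≤-refl (anti (*-monoˡ-≤ s (n≤1+n K)) y∈)) )

        open Levels lev (top≤ K) occupied level-connected consecutive no-jump public
          using (cycle-or-path)

      -- Each of the `suc K` slabs of a chain of length `suc K ^ suc w` has length `suc K ^ w`, just
      -- what the recursion requires after the width has dropped by one.
      chain⇒cycle-or-path : ∀ K w → Chain (suc K ^ w) w →
        ParallelMinor (Cycle (suc K)) G ⊎ ParallelMinor (Path (suc K)) G
      -- Width 0 is absurd: even the empty list is too long.
      chain⇒cycle-or-path K zero    𝒞 = contradiction (Chain.narrow 𝒞 z<s [] []) λ ()
      chain⇒cycle-or-path K (suc w) 𝒞
        with Fin.any? {suc K} (λ r → separated? 𝒞 (toℕ r * suc K ^ w) (suc (toℕ r) * suc K ^ w))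
      ... | yes (r , x , y , x∈ , y∈ , separated) = chain⇒cycle-or-path K w
        (Restrict.restricted 𝒞 (toℕ r * suc K ^ w) (suc K ^ w)
          (*-monoˡ-≤ (suc K ^ w) (Fin.toℕ<n r)) x∈ y∈ separated)
      ... | no all-connected = ConnectedSlabs.cycle-or-path (m^n>0 (suc K) w) 𝒞
        λ {r} {x} {y} r<k x∈ y∈ → decidable-stable (Walk? (Slab? 𝒞 _ _) x y) λ separated →
          ¬∃Fin⇒¬ all-connected r<k (x , y , x∈ , y∈ , separated)

  -- Balls around a vertex and the chain they define

  module _ (v : V) where

    Ball : ℕ → V → Set
    Ball zero    x = x ≡ v
    Ball (suc t) x = Ball t x ⊎ ∃ λ u → x ~ u × Ball t u

    Ball? : ∀ t x → Dec (Ball t x)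
    Ball? zero    x = x Fin.≟ v
    Ball? (suc t) x = Ball? t x ⊎-dec Fin.any? λ u → adj-dec G x u ×-dec Ball? t u

    Ball-connected : ∀ {t x} → Ball t x → Walk (Ball t) x v
    Ball-connected {zero}  refl                = stop refl
    Ball-connected {suc t} (inj₁ b)            = mapWalk inj₁ (Ball-connected b)
    Ball-connected {suc t} (inj₂ (u , a , b))  = step (inj₂ (u , a , b)) a (mapWalk inj₁ (Ball-connected b))

    Ball-centre : ∀ t → Ball t v
    Ball-centre zero    = refl
    Ball-centre (suc t) = inj₁ (Ball-centre t)

    Near : ℕ → V → Set
    Near t x = ¬ Ball t x × ∃ λ u → x ~ u × Ball t u

    Near? : ∀ t x → Dec (Near t x)
    Near? t x = ¬? (Ball? t x) ×-dec Fin.any? λ u → adj-dec G x u ×-dec Ball? t u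

    near : ℕ → List V
    near t = filter (Near? t) (allFin _)

    near! : ∀ t → Unique (near t)
    near! t = filter⁺ (Near? t) (allFin⁺ _)

    ∈-near : ∀ {t x} → Near t x → x ∈ near t
    ∈-near {t} n = ∈-filter⁺ (Near? t) (∈-allFin _) n

    near-∈ : ∀ {t x} → x ∈ near t → Near t x
    near-∈ {t} i = proj₂ (∈-filter⁻ (Near? t) {xs = allFin _} i)

    ball : ℕ → List V
    ball zero    = v ∷ []
    ball (suc t) = near t ++ ball t

    ∈-ball : ∀ {t x} → Ball t x → x ∈ ball t
    ∈-ball {zero}  refl     = here refl
    ∈-ball {suc t} (inj₁ b) = ∈-++⁺ʳ (near t) (∈-ball b)
    ∈-ball {suc t} {x} (inj₂ n) with Ball? t x
    ... | yes b = ∈-++⁺ʳ (near t) (∈-ball b)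
    ... | no ¬b = ∈-++⁺ˡ (∈-near (¬b , n))

    length-ball : ∀ {d} t → (∀ {i} → i < t → length (near i) < d) → length (ball t) ≤ 1 + t * d
    length-ball zero _ = ≤-refl
    length-ball {d} (suc t) small = begin
      length (near t ++ ball t)         ≡⟨ length-++ (near t) ⟩
      length (near t) + length (ball t) ≤⟨ +-mono-≤ (<⇒≤ (small ≤-refl)) (length-ball t (small ∘ m<n⇒m<1+n)) ⟩
      d + (1 + t * d)                   ≡⟨ +-suc d (t * d) ⟩
      1 + (d + t * d)                   ∎
      where open ≤-Reasoning

    module _ (connected : Connected G) {m d : ℕ} (0<m : 0 < m)
      (small : ∀ {t} → t < m → length (near t) < d) {p : V} (p∉ : ¬ Ball m p) where

      Far : ℕ → V → Set
      Far t x = Walk (¬_ ∘ Ball t) x p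

      -- Before a walk from `x` to `v` enters the ball, it stays in the component of `x` outside the
      -- ball, which is not that of `p`; the ball itself is connected to `v`.
      Far-outside : ∀ {t x} → ¬ Far t x → Walk (¬_ ∘ Far t) x v
      Far-outside {t} {x} x∉ with Ball? t x
      ... | yes b = mapWalk (λ b f → start f b) (Ball-connected b)
      ... | no ¬b with enter (Ball? t) (Reach⇒Walk (connected x v)) ¬b (Ball-centre t)
      ...   | u , w , W , u~w , _ , w∈ =
        mapWalk avoid (trace W) ◅◅ step (avoid W) u~w (mapWalk (λ b f → start f b) (Ball-connected w∈))
        where
        avoid : ∀ {z} → Walk (λ z → ⊤ × ¬ Ball t z) x z → ¬ Far t z
        avoid W f = x∉ (mapWalk proj₂ W ◅◅ f)

      -- Neighbours of a vertex outside `Ball (suc t)` are outside `Ball t`, so this initial chain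
      -- has no skipping edges.
      Far-tight : ∀ {t x y} → Far (suc t) y → x ~ y → Far t x
      Far-tight f x~y = step (λ b → start f (inj₂ (_ , adj-sym G x~y , b))) x~y (mapWalk (_∘ inj₁) f)

      -- A walk from `p` to `v` leaves `Far m` along an edge `u ~ w`. As `0 < m`, `u` is in `Far 1`,
      -- and so `w` is in `Far 0`.
      Far-proper : ∃ λ x → Far 0 x × ¬ Far m x
      Far-proper with exit (λ x → Walk? (¬? ∘ Ball? m) x p) (Reach⇒Walk (connected p v))
                        (stop p∉) (λ f → start f (Ball-centre m))
      ... | u , w , W , u~w , _ , w∉ = w , weaken 0<m (proj₂ (end W)) , w∉
        where
        anti : ∀ {t} → Far t u → Far 0 u
        anti {zero}  f = f
        anti {suc t} f = anti (mapWalk (_∘ inj₁) f)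
        weaken : ∀ {m} → 0 < m → Far m u → Far 0 w
        weaken {suc zero}    _ f = Far-tight f (adj-sym G u~w)
        weaken {suc (suc m)} _ f = weaken {suc m} z<s (mapWalk (_∘ inj₁) f)

      -- A neighbour of `y` outside `Ball t` would be connected to `p` through `y`, so `u` must be
      -- in the ball.
      Frontier⇒Near : ∀ {t y} → Frontier v p Far m t y → Near t y
      Frontier⇒Near {t} (f , _ , u , y~u , u∉) = start f , u , y~u ,
        decidable-stable (Ball? t u) (λ ¬b → u∉ (step ¬b (adj-sym G y~u) f))

      ball-chain : Chain v p m d
      ball-chain = record
        { A       = Far
        ; A?      = λ t x → Walk? (¬? ∘ Ball? t) x p
        ; A-anti  = mapWalk (_∘ inj₁)
        ; p∈      = stop p∉
        ; v∉      = λ f → start f refl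
        ; inside  = λ f → mapWalk (λ W → reverse W ◅◅ f) (trace f)
        ; outside = λ _ → Far-outside
        ; tight   = λ _ x∉ f x~y → contradiction (Far-tight f x~y) x∉
        ; proper  = Far-proper
        ; narrow  = λ {t} t<m xs! fr → ≤-<-trans
            (Unique-⊆⇒length≤ xs! (λ i → ∈-near (Frontier⇒Near (All.lookup fr i)))) (small t<m)
        }

  -- Choice of the bound and conclusion

  module _ (K : ℕ) (connected : Connected G) (v : V) where

    -- `d` neighbours suffice for `star-or-complete` to give `suc K` leaves or `suc K` vertices; `m`
    -- is the chain length that `chain⇒cycle-or-path` asks for at width `d`.
    d m : ℕ
    d = ramsey K (suc K)
    m = suc K ^ d

    -- If all radii below `m` have fewer than `d` near vertices, the ball of radius `m` has at most
    -- `1 + m * d` vertices and so misses some `p`.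
    unavoidable : 2 + m * d ≤ order G →
      ParallelMinor (Star (suc K)) G ⊎ ParallelMinor (Cycle (suc K)) G ⊎
      ParallelMinor (Path (suc K)) G ⊎ ParallelMinor (Complete (suc K)) G
    unavoidable large with Fin.any? {m} (λ t → d ≤? length (near v (toℕ t)))
    ... | yes (t , le) =
      [ inj₁ , inj₂ ∘ inj₂ ∘ inj₂ ]′
        (Hub.star-or-complete connected v (Ball-centre v (toℕ t)) (Ball-connected v)
          (near! v (toℕ t)) (near-∈ v) K (suc K) le)
    ... | no none with Fin.any? (¬? ∘ Ball? v m)
    ...   | yes (p , p∉) = inj₂ ([ inj₁ , inj₂ ∘ inj₁ ]′
      (chain⇒cycle-or-path v p connected K d (ball-chain v connected (m^n>0 (suc K) d) (≰⇒> ∘ ¬∃Fin⇒¬ none) p∉)))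
    ...   | no all = contradiction covered (<⇒≱ large)
      where
      covered : order G ≤ 1 + m * d
      covered = begin
        order G                    ≡⟨ length-tabulate id ⟨
        length (allFin (order G))  ≤⟨ Unique-⊆⇒length≤ (allFin⁺ _) (λ {x} _ → ∈-ball v
                                        (decidable-stable (Ball? v m x) (λ ¬b → all (x , ¬b)))) ⟩
        length (ball v m)          ≤⟨ length-ball v m (≰⇒> ∘ ¬∃Fin⇒¬ none) ⟩
        1 + m * d                  ∎
        where open ≤-Reasoning

order-bound : ℕ → ℕ
order-bound zero    = 0
order-bound (suc K) = 2 + suc K ^ d * d
  where d = ramsey K (suc K)

theorem1p4 : Σ (ℕ → ℕ) λ f →
    ∀ (k : ℕ) → 1 ≤ k → ∀ (G : Graph) → Connected G → f k ≤ order G →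
    ParallelMinor (Star k) G ⊎ ParallelMinor (Cycle k) G ⊎
    ParallelMinor (Path k) G ⊎ ParallelMinor (Complete k) G
theorem1p4 = order-bound , λ { (suc K) _ G connected large →
  -- The balls are centred at vertex 0, which exists because the bound is positive.
  Contraction.unavoidable G K connected (fromℕ< (≤-trans z<s large)) large }
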